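{- For every integer $g\geq 3$, the number $i_g(4)$ of numerical semigroups of genus $g$ and multiplicity $4$ that are in an infinite chain is $$\left\lfloor\frac{g+1}{3}\right\rfloor.$$
   Context: A numerical semigroup is a subset $\Lambda\subseteq\mathbb{N}_0=\{0,1,2,\dots\}$ containing $0$, closed under addition, with finite complement in $\mathbb{N}_0$. Its genus is the cardinality of the complement. Its multiplicity is its smallest non-zero element. Its conductor $c(\Lambda)$ is the smallest $c\in\mathbb{N}_0$ with $\{\ell\in\mathbb{N}_0:\ell\ge c\}\subseteq\Lambda$. The effective generators of $\Lambda$ are the minimal generators of $\Lambda$ that are at least $c(\Lambda)$. The children of $\Lambda$ are the numerical semigroups $\Lambda\setminus\{a\}$ with $a$ an effective generator of $\Lambda$; $\Lambda$ is then the parent of each of these. An infinite chain is an infinite sequence of numerical semigroups $\Lambda_0,\Lambda_1,\Lambda_2,\dots$ such that $\Lambda_0=\mathbb{N}_0$ and $\Lambda_i$ is the parent of $\Lambda_{i+1}$ for all $i\ge 0$; a numerical semigroup is in the chain if it is one of the $\Lambda_i$. -}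

module Defs where

open import Data.Fin.Base using (Fin)
open import Data.List.Base using (List)
open import Data.List.Membership.Propositional using (_∉_)
open import Data.Nat.Base using (ℕ; suc; _+_; _≤_)
open import Data.Product.Base using (Σ; ∃; ∃-syntax; _×_; proj₁)
open import Function.Bundles using (Bijection)
open import Level using (Level; 0ℓ) renaming (suc to lsuc)
open import Relation.Binary.Bundles using (Setoid)
open import Relation.Binary.PropositionalEquality as ≡ using (_≡_; _≢_)
import Relation.Binary.Construct.On as On
open import Relation.Unary using (Pred; U; ∁; _⊆_; _≐_; _∖_; ｛_｝)
open import Relation.Unary.Relation.Binary.Equality using (≐-setoid)

private variable
  a p ℓ : Level

HasCardinality : Setoid a ℓ → ℕ → Set _
HasCardinality S n = Bijection (≡.setoid (Fin n)) S

-- Elements of S satisfying P, compared in S: proofs of P do not matter.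
subsetoid : (S : Setoid a ℓ) → Pred (Setoid.Carrier S) p → Setoid _ _
subsetoid S P = On.setoid {B = ∃ P} S proj₁

IsLeast : Pred ℕ ℓ → Pred ℕ ℓ
IsLeast P m = P m × (∀ n → P n → m ≤ n)

-- "Finite complement" is rendered as: the set is the complement of a finite
-- set.  Classically this is the same; constructively it also makes
-- membership decidable.
record NumericalSemigroup : Set₁ where
  field
    Elem              : Pred ℕ 0ℓ
    0-closed          : Elem 0
    +-closed          : ∀ {x y} → Elem x → Elem y → Elem (x + y)
    finite-complement : ∃[ gaps ] Elem ≐ (_∉ gaps)

open NumericalSemigroup public using (Elem)

semigroupSetoid : Setoid (lsuc 0ℓ) 0ℓ
semigroupSetoid = On.setoid (≐-setoid ℕ 0ℓ) Elem

open Setoid semigroupSetoid public using () renaming (_≈_ to _≈ₛ_)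

HasGenus : NumericalSemigroup → ℕ → Set
HasGenus Λ = HasCardinality (subsetoid (≡.setoid ℕ) (∁ (Elem Λ)))

HasMultiplicity : NumericalSemigroup → ℕ → Set
HasMultiplicity Λ = IsLeast (λ n → Elem Λ n × n ≢ 0)

IsConductor : NumericalSemigroup → ℕ → Set
IsConductor Λ = IsLeast (λ c → ∀ l → c ≤ l → Elem Λ l)

-- The submonoid of (ℕ , + , 0) generated by A.
data ⟨_⟩ (A : Pred ℕ 0ℓ) : Pred ℕ 0ℓ where
  gen : ∀ {x} → A x → ⟨ A ⟩ x
  0∈  : ⟨ A ⟩ 0
  _⊕_ : ∀ {x y} → ⟨ A ⟩ x → ⟨ A ⟩ y → ⟨ A ⟩ (x + y)

_Generates_ : Pred ℕ 0ℓ → NumericalSemigroup → Set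
A Generates Λ = ⟨ A ⟩ ≐ Elem Λ

IsMinimalGeneratingSet : Pred ℕ 0ℓ → NumericalSemigroup → Set₁
IsMinimalGeneratingSet A Λ =
  A Generates Λ × (∀ (B : Pred ℕ 0ℓ) → B ⊆ A → B Generates Λ → A ⊆ B)

-- The minimal generating set is unique, so it does not matter which one is
-- taken here.
IsMinimalGenerator : NumericalSemigroup → ℕ → Set₁
IsMinimalGenerator Λ x = ∃[ A ] IsMinimalGeneratingSet A Λ × A x

IsEffectiveGenerator : NumericalSemigroup → ℕ → Set₁
IsEffectiveGenerator Λ x =
  IsMinimalGenerator Λ x × (∃[ c ] IsConductor Λ c × c ≤ x)

_IsParentOf_ : NumericalSemigroup → NumericalSemigroup → Set₁
Λ IsParentOf Λ′ = ∃[ x ] IsEffectiveGenerator Λ x × Elem Λ′ ≐ (Elem Λ ∖ ｛ x ｝)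

record InfiniteChain : Set₁ where
  field
    term   : ℕ → NumericalSemigroup
    start  : Elem (term 0) ≐ U
    parent : ∀ i → term i IsParentOf term (suc i)

IsInInfiniteChain : NumericalSemigroup → Set₁
IsInInfiniteChain Λ = Σ InfiniteChain λ C → ∃[ i ] Λ ≈ₛ InfiniteChain.term C i

chainSemigroups : (g m : ℕ) → Setoid (lsuc 0ℓ) 0ℓ
chainSemigroups g m = subsetoid semigroupSetoid
  λ Λ → HasGenus Λ g × HasMultiplicity Λ m × IsInInfiniteChain Λ

{-# OPTIONS --safe #-}
-- Along an infinite chain the removed elements x₀ < x₁ < … increase strictly,
-- and the i-th semigroup is the complement of {x₀ , … , xᵢ₋₁}, of genus i.  An
-- element of the i-th semigroup below xᵢ₋₁ is never removed later.  If 4 and an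
-- odd number were never removed, then neither would be any large number, so for
-- multiplicity 4 all elements below xᵢ₋₁ are even.  With a least such that
-- 4a + 2 is in the semigroup, the xⱼ with j < i are therefore the first i
-- elements outside  H a = 4ℕ ∪ {even n ≥ 4a}.  Conversely the first g elements
-- outside H a are always removed along an infinite chain, and 4a − 2, the last
-- gap distinguishing H a, comes at position 3a − 2, so the a that occur in
-- genus g, each once, are those with 1 ≤ a and 3a − 2 < g.

module Submission where

open import Defs
open import Data.Nat using (ℕ; _+_; _≥_; _/_)

open import Data.Bool.Base using (if_then_else_)
open import Data.Fin.Base using (Fin; zero; suc; toℕ; fromℕ<)
open import Data.Fin.Properties using (toℕ<n; toℕ-fromℕ<; toℕ-injective)
open import Data.Fin.Permutation using (↔⇒≡)
open import Data.List.Base using (applyUpTo)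
open import Data.List.Membership.DecPropositional Data.Nat._≟_ using (_∈?_)
open import Data.List.Membership.Propositional using (_∉_)
open import Data.List.Membership.Propositional.Properties using (∈-applyUpTo⁺; ∈-applyUpTo⁻)
open import Data.Nat using (zero; suc; _*_; _∸_; _≤_; _<_; z≤n; s≤s; s≤s⁻¹; _≟_; _≤?_; _<?_)
open import Data.Nat.Divisibility
  using (_∣_; _∣?_; divides; divides-refl; ∣1⇒≡1; ∣m+n∣m⇒∣n; ∣m∣n⇒∣m+n; ∣-trans; _∣0; ∣-refl)
open import Data.Nat.DivMod using (m≡m%n+[m/n]*n; m%n<n; m/n*n≤m; /-monoˡ-≤; m*n/n≡m; _%_; _divMod_; result)
open import Data.Nat.Induction using (<-rec)
open import Data.Nat.Properties
open import Data.Nat.Tactic.RingSolver using (solve-∀)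
open import Data.Product.Base using (∃; ∃-syntax; _×_; _,_; proj₁; proj₂)
open import Data.Sum.Base using (_⊎_; inj₁; inj₂)
open import Function.Base using (_∘_; case_of_)
open import Function.Properties.Bijection using (Bijection⇒Inverse)
import Function.Properties.Inverse as Inverse
open import Level using (Level; 0ℓ)
open import Relation.Binary.Bundles using (Setoid)
open import Relation.Binary.Definitions using (tri<; tri≈; tri>)
open import Relation.Binary.PropositionalEquality
open import Relation.Nullary using (¬_; yes; no; does; contradiction)
open import Relation.Nullary.Decidable using (map′; ¬?; _×-dec_; _⊎-dec_; dec-true; dec-false; from-no)
open import Relation.Unary using (Pred; Decidable; _≐_; ∁; _∖_; ｛_｝)
open import Relation.Unary.Properties using (≐-refl; ≐-sym; ≐-trans)

open NumericalSemigroup using (0-closed; +-closed; finite-complement)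

private variable
  a ℓ : Level

-- Strictly increasing sequences

Increasing : (ℕ → ℕ) → Set
Increasing f = ∀ i → f i < f (suc i)

module _ {f : ℕ → ℕ} (inc : Increasing f) where

  increasing⇒mono-< : ∀ {i j} → i < j → f i < f j
  increasing⇒mono-< {i} {suc j} i<1+j with m≤n⇒m<n∨m≡n (s≤s⁻¹ i<1+j)
  ... | inj₁ i<j  = <-trans (increasing⇒mono-< i<j) (inc j)
  ... | inj₂ refl = inc j

  increasing⇒mono-≤ : ∀ {i j} → i ≤ j → f i ≤ f j
  increasing⇒mono-≤ i≤j with m≤n⇒m<n∨m≡n i≤j
  ... | inj₁ i<j  = <⇒≤ (increasing⇒mono-< i<j)
  ... | inj₂ refl = ≤-refl

  increasing⇒cancel-< : ∀ {i j} → f i < f j → i < j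
  increasing⇒cancel-< fi<fj = ≰⇒> (<⇒≱ fi<fj ∘ increasing⇒mono-≤)

  increasing⇒injective : ∀ {i j} → f i ≡ f j → i ≡ j
  increasing⇒injective {i} {j} eq with <-cmp i j
  ... | tri< i<j _ _ = contradiction eq (<⇒≢ (increasing⇒mono-< i<j))
  ... | tri≈ _ i≡j _ = i≡j
  ... | tri> _ _ j<i = contradiction (sym eq) (<⇒≢ (increasing⇒mono-< j<i))

  increasing⇒≥id : ∀ i → i ≤ f i
  increasing⇒≥id zero    = z≤n
  increasing⇒≥id (suc i) = ≤-<-trans (increasing⇒≥id i) (inc i)

-- Induction: `f j ≤ h j < h (suc j) = f k` forces `j < k`. Used in both directions, it identifies
-- two enumerations.
enumeration-≤ : ∀ {f h n} → Increasing f → Increasing h →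
                (∀ {j} → j < n → ∃[ k ] f k ≡ h j) → ∀ {j} → j < n → f j ≤ h j
enumeration-≤ {f} {h} inc-f inc-h range {zero} 0<n with range 0<n
... | k , fk≡h0 = subst (f 0 ≤_) fk≡h0 (increasing⇒mono-≤ inc-f z≤n)
enumeration-≤ {f} {h} inc-f inc-h range {suc j} 1+j<n with range 1+j<n
... | k , fk≡h = subst (f (suc j) ≤_) fk≡h
  (increasing⇒mono-≤ inc-f (increasing⇒cancel-< inc-f
    (≤-<-trans (enumeration-≤ inc-f inc-h range (<⇒≤ 1+j<n))
               (subst (h j <_) (sym fk≡h) (inc-h j)))))

-- Complements of initial segments of sequences

module _ (f : ℕ → ℕ) where

  ∉-applyUpTo⁺ : ∀ {n x} → (∀ {j} → j < n → f j ≢ x) → x ∉ applyUpTo f n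
  ∉-applyUpTo⁺ avoids x∈ with ∈-applyUpTo⁻ f x∈
  ... | j , j<n , x≡fj = avoids j<n (sym x≡fj)

  ∉-applyUpTo⁻ : ∀ {n x} → x ∉ applyUpTo f n → ∀ {j} → j < n → f j ≢ x
  ∉-applyUpTo⁻ x∉ j<n refl = x∉ (∈-applyUpTo⁺ f j<n)

  ∉-applyUpTo-suc : ∀ n → (_∉ applyUpTo f (suc n)) ≐ ((_∉ applyUpTo f n) ∖ ｛ f n ｝)
  ∉-applyUpTo-suc n =
    (λ x∉ → ∉-applyUpTo⁺ (∉-applyUpTo⁻ x∉ ∘ m≤n⇒m≤1+n) , ∉-applyUpTo⁻ x∉ ≤-refl) ,
    λ (x∉ , fn≢x) → ∉-applyUpTo⁺ λ j<1+n → case m≤n⇒m<n∨m≡n (s≤s⁻¹ j<1+n) of λ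
      { (inj₁ j<n)  → ∉-applyUpTo⁻ x∉ j<n
      ; (inj₂ refl) → fn≢x
      }

enumeration⇒genus : ∀ Λ {f n} → Increasing f → Elem Λ ≐ (_∉ applyUpTo f n) → HasGenus Λ n
enumeration⇒genus Λ {f} {n} inc eq = record
  { to        = λ i → f (toℕ i) , λ fi∈ → proj₁ eq fi∈ (∈-applyUpTo⁺ f (toℕ<n i))
  ; cong      = cong (f ∘ toℕ)
  ; bijective = toℕ-injective ∘ increasing⇒injective inc , surjective
  }
  where
  surjective : ∀ y → ∃[ i ] (∀ {z} → z ≡ i → f (toℕ z) ≡ proj₁ y)
  surjective (x , x∉Λ) with x ∈? applyUpTo f n
  ... | no x∉  = contradiction (proj₂ eq x∉) x∉Λ
  ... | yes x∈ with ∈-applyUpTo⁻ f x∈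
  ...   | j , j<n , refl = fromℕ< j<n , λ { refl → cong f (toℕ-fromℕ< j<n) }

cardinality-unique : {S : Setoid a ℓ} → ∀ {m n} → HasCardinality S m → HasCardinality S n → m ≡ n
cardinality-unique A B = ↔⇒≡ (Inverse.trans (Bijection⇒Inverse A) (Inverse.sym (Bijection⇒Inverse B)))

-- Numerical semigroups

Elem? : ∀ Λ → Decidable (Elem Λ)
Elem? Λ n with finite-complement Λ
... | gaps , ⊆ , ⊇ = map′ ⊇ ⊆ (¬? (n ∈? gaps))

multiple-closed : ∀ Λ k {x} → Elem Λ x → Elem Λ (k * x)
multiple-closed Λ zero    x∈ = 0-closed Λ
multiple-closed Λ (suc k) x∈ = +-closed Λ x∈ (multiple-closed Λ k x∈)

Irreducible : NumericalSemigroup → Pred ℕ 0ℓ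
Irreducible Λ x =
  Elem Λ x × x ≢ 0 × (∀ {y z} → Elem Λ y → Elem Λ z → y ≢ 0 → z ≢ 0 → y + z ≢ x)

irreducibles-generate : ∀ Λ → Irreducible Λ Generates Λ
irreducibles-generate Λ = sound , <-rec _ complete _
  where
  sound : ∀ {x} → ⟨ Irreducible Λ ⟩ x → Elem Λ x
  sound (gen (x∈ , _)) = x∈
  sound 0∈             = 0-closed Λ
  sound (p ⊕ q)        = +-closed Λ (sound p) (sound q)

  complete : ∀ x → (∀ {y} → y < x → Elem Λ y → ⟨ Irreducible Λ ⟩ y) → Elem Λ x → ⟨ Irreducible Λ ⟩ x
  complete x rec x∈ with x ≟ 0
  ... | yes refl = 0∈
  ... | no x≢0
    with anyUpTo? (λ y → ¬? (y ≟ 0) ×-dec Elem? Λ y ×-dec Elem? Λ (x ∸ y)) x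
  ...   | yes (y , y<x , y≢0 , y∈ , x∸y∈) =
    subst ⟨ Irreducible Λ ⟩ (m+[n∸m]≡n (<⇒≤ y<x))
      (rec y<x y∈ ⊕ rec (∸-monoʳ-< (n≢0⇒n>0 y≢0) (<⇒≤ y<x)) x∸y∈)
  ...   | no irr = gen (x∈ , x≢0 , λ { {y} {z} y∈ z∈ y≢0 z≢0 refl →
    irr (y , m<m+n y (n≢0⇒n>0 z≢0) , y≢0 , y∈ , subst (Elem Λ) (sym (m+n∸m≡n y z)) z∈) })

-- Any expression of an irreducible element as a sum of generators has only one nonzero summand, so
-- every generating set contains that element.
irreducible⇒minimalGenerator : ∀ Λ {x} → Irreducible Λ x → IsMinimalGenerator Λ x
irreducible⇒minimalGenerator Λ x-irr =
  Irreducible Λ , (irreducibles-generate Λ , minimal) , x-irr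
  where
  minimal : ∀ B → (∀ {x} → B x → Irreducible Λ x) → B Generates Λ → ∀ {x} → Irreducible Λ x → B x
  minimal B _ (⟨B⟩⊆Λ , Λ⊆⟨B⟩) irr = extract (Λ⊆⟨B⟩ (proj₁ irr)) irr
    where
    extract : ∀ {x} → ⟨ B ⟩ x → Irreducible Λ x → B x
    extract (gen Bx) _ = Bx
    extract 0∈ (_ , 0≢0 , _) = contradiction refl 0≢0
    extract (_⊕_ {y} {z} p q) irr@(_ , _ , split) with y ≟ 0 | z ≟ 0
    ... | yes refl | _        = extract q irr
    ... | no _     | yes refl = subst B (sym (+-identityʳ y))
      (extract p (subst (Irreducible Λ) (+-identityʳ y) irr))
    ... | no y≢0   | no z≢0   = contradiction refl (split (⟨B⟩⊆Λ p) (⟨B⟩⊆Λ q) y≢0 z≢0)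

minimalGenerator⇒∈ : ∀ Λ {x} → IsMinimalGenerator Λ x → Elem Λ x
minimalGenerator⇒∈ Λ (A , ((⟨A⟩⊆Λ , _) , _) , x∈A) = ⟨A⟩⊆Λ (gen x∈A)

odd-square : ∀ m → (1 + m * 2) * (1 + m * 2) ≡ 1 + (m * m + m) * 4
odd-square = solve-∀

-- The square 1 + 4t of an odd element is 1 modulo 4.
contains-4-and-odd⇒cofinite : ∀ m → ∃[ b ] (∀ Λ → Elem Λ 4 → Elem Λ (1 + m * 2) → ∀ N → b ≤ N → Elem Λ N)
-- Reaching residue `r` uses `r` copies of `1 + t * 4`. As `r ≤ 3`, this needs at most `3 * t` of
-- the fours in `N`.
contains-4-and-odd⇒cofinite m = 3 * t * 4 , contains
  where
  t = m * m + m

  regroup : ∀ r d t → r + (r * t + d) * 4 ≡ r * (1 + t * 4) + d * 4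
  regroup = solve-∀

  contains : ∀ Λ → Elem Λ 4 → Elem Λ (1 + m * 2) → ∀ N → 3 * t * 4 ≤ N → Elem Λ N
  contains Λ 4∈ odd∈ N b≤N = subst (Elem Λ) (sym N≡)
    (+-closed Λ (multiple-closed Λ r (subst (Elem Λ) (odd-square m) (multiple-closed Λ (1 + m * 2) odd∈)))
                (multiple-closed Λ (N / 4 ∸ r * t) 4∈))
    where
    open ≡-Reasoning
    r = N % 4

    rt≤N/4 : r * t ≤ N / 4
    rt≤N/4 = ≤-trans (*-monoˡ-≤ t (s≤s⁻¹ (m%n<n N 4)))
      (subst (_≤ N / 4) (m*n/n≡m (3 * t) 4) (/-monoˡ-≤ 4 b≤N))

    N≡ : N ≡ r * (1 + t * 4) + (N / 4 ∸ r * t) * 4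
    N≡ = begin
      N                                       ≡⟨ m≡m%n+[m/n]*n N 4 ⟩
      r + (N / 4) * 4                         ≡⟨ cong (λ q → r + q * 4) (m+[n∸m]≡n rt≤N/4) ⟨
      r + (r * t + (N / 4 ∸ r * t)) * 4       ≡⟨ regroup r (N / 4 ∸ r * t) t ⟩
      r * (1 + t * 4) + (N / 4 ∸ r * t) * 4   ∎

-- Parity

2∤1+even : ∀ {n} → 2 ∣ n → ¬ 2 ∣ suc n
2∤1+even {n} 2∣n 2∣1+n =
  contradiction (∣1⇒≡1 (∣m+n∣m⇒∣n (subst (2 ∣_) (+-comm 1 n) 2∣1+n) 2∣n)) λ ()

4∣⇒2∣ : ∀ {n} → 4 ∣ n → 2 ∣ n
4∣⇒2∣ = ∣-trans (divides 2 refl)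

4∤2+4* : ∀ j → ¬ 4 ∣ 2 + j * 4
4∤2+4* j 4∣ = from-no (4 ∣? 2) (∣m+n∣m⇒∣n (subst (4 ∣_) (+-comm 2 (j * 4)) 4∣) (divides-refl j))

2∣2+4* : ∀ j → 2 ∣ 2 + j * 4
2∣2+4* j = ∣m∣n⇒∣m+n ∣-refl (4∣⇒2∣ (divides-refl j))

-- Residues 1 and 3 share a constructor, since only oddness matters for them.
data Mod4View : ℕ → Set where
  0mod4 : ∀ j → Mod4View (j * 4)
  2mod4 : ∀ j → Mod4View (2 + j * 4)
  odd   : ∀ m → Mod4View (1 + m * 2)

mod4View : ∀ n → Mod4View n
mod4View n with n divMod 4
... | result q zero refl                   = 0mod4 q
... | result q (suc zero) refl             = subst Mod4View (lemma q) (odd (q * 2))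
  where
  lemma : ∀ q → 1 + (q * 2) * 2 ≡ 1 + q * 4
  lemma = solve-∀
... | result q (suc (suc zero)) refl       = 2mod4 q
... | result q (suc (suc (suc zero))) refl = subst Mod4View (lemma q) (odd (1 + q * 2))
  where
  lemma : ∀ q → 1 + (1 + q * 2) * 2 ≡ 3 + q * 4
  lemma = solve-∀

-- Chains that remove everything outside a set of even numbers

module EvenSubmonoid
  (H : Pred ℕ 0ℓ) (H? : Decidable H) (0∈H : H 0)
  (H-+-closed : ∀ {x y} → H x → H y → H (x + y)) (H⇒2∣ : ∀ {x} → H x → 2 ∣ x)
  where

  -- The least number above n outside H: of two consecutive numbers, one is odd.
  next : ℕ → ℕ
  next n = if does (H? (suc n)) then suc (suc n) else suc n

  next-∈ : ∀ {n} → H (suc n) → next n ≡ suc (suc n)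
  next-∈ {n} h rewrite dec-true (H? (suc n)) h = refl

  next-∉ : ∀ {n} → ¬ H (suc n) → next n ≡ suc n
  next-∉ {n} ¬h rewrite dec-false (H? (suc n)) ¬h = refl

  next-outside : ∀ n → ¬ H (next n)
  next-outside n with H? (suc n)
  ... | yes h = 2∤1+even (H⇒2∣ h) ∘ H⇒2∣
  ... | no ¬h = ¬h

  n<next : ∀ n → n < next n
  n<next n with H? (suc n)
  ... | yes _ = m≤n⇒m≤1+n ≤-refl
  ... | no  _ = ≤-refl

  next-least : ∀ n {m} → ¬ H m → n < m → next n ≤ m
  next-least n m∉H n<m with H? (suc n)
  ... | no  _ = n<m
  ... | yes h = ≤∧≢⇒< n<m λ { refl → m∉H h }

  -- The increasing enumeration of the complement of `H`; it starts at 1 because 0 is in `H` and 1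
  -- is odd.
  gap : ℕ → ℕ
  gap zero    = 1
  gap (suc i) = next (gap i)

  gap-increasing : Increasing gap
  gap-increasing i = n<next (gap i)

  i<gap : ∀ i → i < gap i
  i<gap zero    = ≤-refl
  i<gap (suc i) = ≤-<-trans (i<gap i) (gap-increasing i)

  gap-outside : ∀ i → ¬ H (gap i)
  gap-outside zero    = 2∤1+even (2 ∣0) ∘ H⇒2∣
  gap-outside (suc i) = next-outside (gap i)

  -- Descend from index `m`, where `m < gap m`; no number outside `H` lies strictly between
  -- consecutive gaps.
  outside⇒gap : ∀ {m} → ¬ H m → ∃[ k ] gap k ≡ m
  outside⇒gap {m} m∉H = search m (i<gap m)
    where
    search : ∀ i → m < gap i → ∃[ k ] gap k ≡ m
    search zero    m<1 = contradiction (subst H (sym (n<1⇒n≡0 m<1)) 0∈H) m∉H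
    search (suc i) m<next with <-cmp m (gap i)
    ... | tri< m<gap _ _ = search i m<gap
    ... | tri≈ _ m≡gap _ = i , sym m≡gap
    ... | tri> _ _ gap<m = contradiction m<next (≤⇒≯ (next-least (gap i) m∉H gap<m))

  ∈⇒survives : ∀ i {x} → H x → x ∉ applyUpTo gap i
  ∈⇒survives i x∈H = ∉-applyUpTo⁺ gap λ { {j} _ refl → gap-outside j x∈H }

  survives-below⇒∈ : ∀ {i j x} → j ≤ i → x ∉ applyUpTo gap i → x < gap j → H x
  survives-below⇒∈ {x = x} j≤i x∉ x<gapj with H? x
  ... | yes x∈H = x∈H
  ... | no  x∉H with outside⇒gap x∉H
  ...   | k , refl = contradiction refl
    (∉-applyUpTo⁻ gap x∉ {k} (<-≤-trans (increasing⇒cancel-< gap-increasing {k} x<gapj) j≤i))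

  -- A sum of two nonzero numbers below gap j, both surviving, is a sum in H.
  sum-survives : ∀ {i j x y} → j ≤ i → x ∉ applyUpTo gap i → y ∉ applyUpTo gap i →
                 x < gap j → y < gap j → x + y ≢ gap j
  sum-survives {j = j} j≤i x∉ y∉ x< y< x+y≡ = gap-outside j (subst H x+y≡
    (H-+-closed (survives-below⇒∈ j≤i x∉ x<) (survives-below⇒∈ j≤i y∉ y<)))

  semigroup : ℕ → NumericalSemigroup
  semigroup i = record
    { Elem              = _∉ applyUpTo gap i
    ; 0-closed          = ∈⇒survives i 0∈H
    -- If the sum were a removed gap, each summand would be at most that gap, and different from it
    -- because it survives.
    ; +-closed          = λ {x} {y} x∉ y∉ → ∉-applyUpTo⁺ gap λ j<i gapj≡ →
        sum-survives (<⇒≤ j<i) x∉ y∉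
          (≤∧≢⇒< (subst (x ≤_) (sym gapj≡) (m≤m+n x y)) (∉-applyUpTo⁻ gap x∉ j<i ∘ sym))
          (≤∧≢⇒< (subst (y ≤_) (sym gapj≡) (m≤n+m y x)) (∉-applyUpTo⁻ gap y∉ j<i ∘ sym))
          (sym gapj≡)
    ; finite-complement = applyUpTo gap i , ≐-refl
    }

  gap-irreducible : ∀ i → Irreducible (semigroup i) (gap i)
  gap-irreducible i =
    ∉-applyUpTo⁺ gap (λ j<i → <⇒≢ (increasing⇒mono-< gap-increasing j<i)) ,
    m<n⇒n≢0 (i<gap i) ,
    λ {y} {z} y∉ z∉ y≢0 z≢0 y+z≡ → sum-survives ≤-refl y∉ z∉
      (subst (y <_) y+z≡ (m<m+n y (n≢0⇒n>0 z≢0)))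
      (subst (z <_) y+z≡ (m<n+m z (n≢0⇒n>0 y≢0)))
      y+z≡

  -- The last removed gap is the largest one, so the conductor is its successor, which is at most
  -- the next gap.
  conductor-≤-gap : ∀ i → ∃[ c ] IsConductor (semigroup i) c × c ≤ gap i
  conductor-≤-gap zero    = 0 , ((λ _ _ ()) , λ _ _ → z≤n) , z≤n
  conductor-≤-gap (suc i) = suc (gap i) ,
    ( (λ l gap<l → ∉-applyUpTo⁺ gap λ j<1+i →
        <⇒≢ (≤-<-trans (increasing⇒mono-≤ gap-increasing (s≤s⁻¹ j<1+i)) gap<l))
    , λ c tail → ≰⇒> λ c≤gap → ∉-applyUpTo⁻ gap (tail (gap i) c≤gap) ≤-refl refl) ,
    gap-increasing i

  chain : InfiniteChain
  chain = record
    { term   = semigroup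
    ; start  = _ , λ _ ()
    ; parent = λ i → gap i ,
        (irreducible⇒minimalGenerator (semigroup i) (gap-irreducible i) , conductor-≤-gap i) ,
        ∉-applyUpTo-suc gap i
    }

-- The sequence of elements removed along a chain

module _ (C : InfiniteChain) where
  open InfiniteChain C

  removed : ℕ → ℕ
  removed i = proj₁ (parent i)

  removed∈term : ∀ i → Elem (term i) (removed i)
  removed∈term i = minimalGenerator⇒∈ (term i) (proj₁ (proj₁ (proj₂ (parent i))))

  removed∉term : ∀ i → ¬ Elem (term (suc i)) (removed i)
  removed∉term i x∈ = proj₂ (proj₁ (proj₂ (proj₂ (parent i))) x∈) refl

  -- The next removed element is at least the conductor, while the one just removed is missing and
  -- so lies below it.
  removed-increasing : Increasing removed
  removed-increasing i with proj₂ (proj₁ (proj₂ (parent (suc i))))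
  ... | c , (tail , _) , c≤x =
    ≰⇒> λ x≤ → removed∉term i (tail (removed i) (≤-trans c≤x x≤))

  term≐ : ∀ i → Elem (term i) ≐ (_∉ applyUpTo removed i)
  term≐ zero    = (λ _ ()) , λ _ → proj₂ start _
  term≐ (suc i) with proj₂ (proj₂ (parent i)) | term≐ i | ∉-applyUpTo-suc removed i
  ... | p⊆ , p⊇ | t⊆ , t⊇ | s⊆ , s⊇ =
    (λ x∈ → let y∈ , x≢ = p⊆ x∈ in s⊇ (t⊆ y∈ , x≢)) ,
    (λ x∉ → let y∉ , x≢ = s⊆ x∉ in p⊇ (t⊇ y∉ , x≢))

  -- Nothing removed before stage `i` equals `x`, and everything removed from then on exceeds
  -- `removed j`.
  below-removed⇒∈ : ∀ {i j x} → j < i → Elem (term i) x → x ≤ removed j → ∀ k → Elem (term k) x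
  below-removed⇒∈ {i} {j} {x} j<i x∈ x≤ k = proj₂ (term≐ k) (∉-applyUpTo⁺ removed λ {l} _ x≡ →
    case l <? i of λ
      { (yes l<i) → ∉-applyUpTo⁻ removed (proj₁ (term≐ i) x∈) l<i x≡
      ; (no  l≮i) → <⇒≱ (increasing⇒mono-< removed-increasing (<-≤-trans j<i (≮⇒≥ l≮i)))
                        (subst (_≤ removed j) (sym x≡) x≤)
      })

  -- The bound `b` depends only on `m`, so it serves all terms at once; but `removed b ≥ b` is
  -- missing from term `suc b`.
  ¬4-and-odd-survive : ∀ m → (∀ k → Elem (term k) 4) → ¬ (∀ k → Elem (term k) (1 + m * 2))
  ¬4-and-odd-survive m 4∈ odd∈ with contains-4-and-odd⇒cofinite m
  ... | b , contains = removed∉term b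
    (contains (term (suc b)) (4∈ _) (odd∈ _) (removed b) (increasing⇒≥id removed-increasing b))

-- The family of semigroups of multiplicity 4

-- This is the submonoid generated by 4 and 4a + 2.
H : ℕ → Pred ℕ 0ℓ
H a n = 4 ∣ n ⊎ (2 ∣ n × a * 4 ≤ n)

H? : ∀ a → Decidable (H a)
H? a n = (4 ∣? n) ⊎-dec ((2 ∣? n) ×-dec (a * 4 ≤? n))

H⇒2∣ : ∀ a {n} → H a n → 2 ∣ n
H⇒2∣ a (inj₁ 4∣n)       = 4∣⇒2∣ 4∣n
H⇒2∣ a (inj₂ (2∣n , _)) = 2∣n

H-+-closed : ∀ a {x y} → H a x → H a y → H a (x + y)
H-+-closed a (inj₁ 4∣x) (inj₁ 4∣y) = inj₁ (∣m∣n⇒∣m+n 4∣x 4∣y)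
H-+-closed a hx@(inj₂ (_ , ≤x)) hy = inj₂ (∣m∣n⇒∣m+n (H⇒2∣ a hx) (H⇒2∣ a hy) , ≤-trans ≤x (m≤m+n _ _))
H-+-closed a hx@(inj₁ _) hy@(inj₂ (_ , ≤y)) = inj₂ (∣m∣n⇒∣m+n (H⇒2∣ a hx) (H⇒2∣ a hy) , ≤-trans ≤y (m≤n+m _ _))

2+4*∈H⁺ : ∀ {a j} → a ≤ j → H a (2 + j * 4)
2+4*∈H⁺ {a} {j} a≤j = inj₂ (2∣2+4* j , ≤-trans (*-monoˡ-≤ 4 a≤j) (m≤n+m _ 2))

2+4*∈H⁻ : ∀ {a j} → H a (2 + j * 4) → a ≤ j
2+4*∈H⁻ {j = j} (inj₁ 4∣) = contradiction 4∣ (4∤2+4* j)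
2+4*∈H⁻ {a} {j} (inj₂ (_ , a*4≤)) =
  s≤s⁻¹ (*-cancelʳ-< 4 a (suc j) (≤-<-trans a*4≤ (s≤s (m≤n⇒m≤1+n ≤-refl))))

module Family (a : ℕ) =
  EvenSubmonoid (H a) (H? a) (inj₁ (4 ∣0)) (H-+-closed a) (H⇒2∣ a)

open Family using (gap; semigroup)

-- Below 4a, the elements outside H a are those that are not multiples of 4.
gap-1+3* : ∀ a j → j < a → gap a (1 + j * 3) ≡ 2 + j * 4
gap-1+3* a zero 0<a = next-∉ (<⇒≱ 0<a ∘ 2+4*∈H⁻ {a} {0})
  where open Family a using (next; next-∈; next-∉)
-- Each block of four holds three gaps: after 4j + 2 come 4j + 3, 4j + 5 and 4j + 6, skipping the
-- multiple of 4.
gap-1+3* a (suc j) 1+j<a = begin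
  next (next (next (gap a (1 + j * 3)))) ≡⟨ cong (next ∘ next ∘ next) (gap-1+3* a j (<⇒≤ 1+j<a)) ⟩
  next (next (next (2 + j * 4)))         ≡⟨ cong (next ∘ next) (next-∉ (2∤1+even (2∣2+4* j) ∘ H⇒2∣ a)) ⟩
  next (next (3 + j * 4))                ≡⟨ cong next (next-∈ (inj₁ (divides-refl (suc j)))) ⟩
  next (5 + j * 4)                       ≡⟨ next-∉ (<⇒≱ 1+j<a ∘ 2+4*∈H⁻ {a} {suc j}) ⟩
  6 + j * 4                              ∎
  where
  open ≡-Reasoning
  open Family a using (next; next-∈; next-∉; ∈⇒survives; survives-below⇒∈; i<gap)

-- Since `gap 3 > 3`, three removals suffice for every survivor below 4 to lie in `H a`, which omits
-- 1, 2 and 3.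
semigroup-multiplicity : ∀ {a g} → 1 ≤ a → 3 ≤ g → HasMultiplicity (semigroup a g) 4
semigroup-multiplicity {a} {g} 1≤a 3≤g =
  (∈⇒survives g (inj₁ ∣-refl) , λ ()) ,
  λ n (n∈ , n≢0) → ≮⇒≥ λ n<4 → outside n n≢0 n<4 (survives-below⇒∈ 3≤g n∈ (<-≤-trans n<4 (i<gap 3)))
  where
  open Family a using (next; next-∈; next-∉; ∈⇒survives; survives-below⇒∈; i<gap)
  outside : ∀ n → n ≢ 0 → n < 4 → ¬ H a n
  outside 0 0≢0 _ _ = 0≢0 refl
  outside 1 _   _ h = from-no (2 ∣? 1) (H⇒2∣ a h)
  outside 2 _   _ h = <⇒≱ 1≤a (2+4*∈H⁻ {a} {0} h)
  outside 3 _   _ h = from-no (2 ∣? 3) (H⇒2∣ a h)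
  outside (suc (suc (suc (suc _)))) _ (s≤s (s≤s (s≤s (s≤s ()))))

-- The number 4b + 2 separates the two: if `a ≤ b` it survives on the left, while on the right it is
-- the gap of index `1 + b * 3`, which the bound places below `g`.
semigroup-⊆⇒≤ : ∀ a b g → suc b * 3 ≤ g + 1 →
                (∀ {x} → Elem (semigroup a g) x → Elem (semigroup (suc b) g) x) → suc b ≤ a
semigroup-⊆⇒≤ a b g 3b≤g+1 ⊆ = ≰⇒> λ a≤b →
  ∉-applyUpTo⁻ (gap (suc b)) (⊆ (Family.∈⇒survives a g (2+4*∈H⁺ a≤b)))
    (s≤s⁻¹ (subst (suc b * 3 ≤_) (+-comm g 1) 3b≤g+1)) (gap-1+3* (suc b) b ≤-refl)

semigroup-inChain : ∀ {a g} → 1 ≤ a → 3 ≤ g →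
  HasGenus (semigroup a g) g × HasMultiplicity (semigroup a g) 4 × IsInInfiniteChain (semigroup a g)
semigroup-inChain {a} {g} 1≤a 3≤g =
  enumeration⇒genus (semigroup a g) (Family.gap-increasing a) ≐-refl ,
  semigroup-multiplicity 1≤a 3≤g ,
  Family.chain a , g , ≐-refl

-- Classification

least : ∀ {P : Pred ℕ 0ℓ} → Decidable P → ∀ {n} → P n → ∃ (IsLeast P)
least {P} P? {n} = <-rec (λ n → P n → ∃ (IsLeast P)) search n
  where
  search : ∀ n → (∀ {m} → m < n → P m → ∃ (IsLeast P)) → P n → ∃ (IsLeast P)
  search n rec Pn with anyUpTo? P? n
  ... | yes (m , m<n , Pm) = rec m<n Pm
  ... | no none = n , Pn , λ m Pm → ≮⇒≥ λ m<n → none (m , m<n , Pm)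

classification : ∀ {g} Λ → HasGenus Λ g → HasMultiplicity Λ 4 → IsInInfiniteChain Λ →
                 ∃[ b ] suc b * 3 ≤ g + 1 × Λ ≈ₛ semigroup (suc b) g
classification {g} Λ genus ((4∈Λ , _) , 4≤) (C , i , Λ≐term)
  -- The `i`-th term has genus `i`, so `Λ` sits at position `g`.
  with refl ← cardinality-unique {S = subsetoid (setoid ℕ) (∁ (Elem Λ))}
         (enumeration⇒genus Λ (removed-increasing C) (≐-trans Λ≐term (term≐ C i))) genus
  -- To start the search, 2 + 4 `removed C g` exceeds every element removed before stage `g`. The
  -- least index is the parameter a; it is nonzero because 2 is not in `Λ`.
  with least (λ j → Elem? Λ (2 + j * 4)) {removed C g} large∈Λ
  where
  large∈Λ : Elem Λ (2 + removed C g * 4)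
  large∈Λ = proj₂ (≐-trans Λ≐term (term≐ C g)) (∉-applyUpTo⁺ (removed C) λ j<g →
    <⇒≢ (<-≤-trans (increasing⇒mono-< (removed-increasing C) j<g)
                   (≤-trans (m≤m*n (removed C g) 4) (m≤n+m _ 2))))
... | zero  , 2∈Λ , _ = contradiction (4≤ 2 (2∈Λ , λ ())) (λ { (s≤s (s≤s ())) })
... | suc b , 2+4a∈Λ , a≤ = b , bound , Λ≐semigroup
  where
  open Family (suc b) using (outside⇒gap; gap-outside; gap-increasing)
  x = removed C

  Λ≐ : Elem Λ ≐ (_∉ applyUpTo x g)
  Λ≐ = ≐-trans Λ≐term (term≐ C g)

  H⊆Λ : ∀ {n} → H (suc b) n → Elem Λ n
  H⊆Λ {n} n∈H with mod4View n
  ... | 0mod4 j = multiple-closed Λ j 4∈Λ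
  ... | 2mod4 j = subst (λ d → Elem Λ (2 + d))
    (trans (sym (*-distribʳ-+ 4 (suc b) (j ∸ suc b))) (cong (_* 4) (m+[n∸m]≡n (2+4*∈H⁻ {suc b} {j} n∈H))))
    (+-closed Λ 2+4a∈Λ (multiple-closed Λ (j ∸ suc b) 4∈Λ))
  ... | odd m   = contradiction (H⇒2∣ (suc b) n∈H) (2∤1+even (divides-refl m))

  below⇒∈H : ∀ {j n} → j < g → Elem Λ n → n ≤ x j → H (suc b) n
  below⇒∈H {j} {n} j<g n∈Λ n≤xj with mod4View n
  ... | 0mod4 q = inj₁ (divides-refl q)
  ... | 2mod4 q = 2+4*∈H⁺ (a≤ q n∈Λ)
  -- Being the multiplicity, 4 is at most `n`, so 4 and the odd `n` would both survive forever.
  ... | odd m   = contradiction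
    (below-removed⇒∈ C j<g (proj₁ Λ≐term n∈Λ) n≤xj)
    (¬4-and-odd-survive C m
      (below-removed⇒∈ C j<g (proj₁ Λ≐term 4∈Λ) (≤-trans (4≤ n (n∈Λ , λ ())) n≤xj)))

  gap≤x : ∀ {j} → j < g → gap (suc b) j ≤ x j
  gap≤x = enumeration-≤ gap-increasing (removed-increasing C) λ j<g →
    outside⇒gap λ xj∈H → ∉-applyUpTo⁻ x (proj₁ Λ≐ (H⊆Λ xj∈H)) j<g refl

  -- By `gap≤x`, a gap still in `Λ` would be at most `x j`, hence in `H`; so each of the first `g`
  -- gaps has been removed.
  x≤gap : ∀ {j} → j < g → x j ≤ gap (suc b) j
  x≤gap = enumeration-≤ (removed-increasing C) gap-increasing gap-removed
    where
    gap-removed : ∀ {j} → j < g → ∃[ k ] x k ≡ gap (suc b) j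
    gap-removed {j} j<g with gap (suc b) j ∈? applyUpTo x g
    ... | yes gap∈ = let k , _ , eq = ∈-applyUpTo⁻ x gap∈ in k , sym eq
    ... | no  gap∉ = contradiction (below⇒∈H j<g (proj₂ Λ≐ gap∉) (gap≤x j<g)) (gap-outside j)

  x≡gap : ∀ {j} → j < g → x j ≡ gap (suc b) j
  x≡gap j<g = ≤-antisym (x≤gap j<g) (gap≤x j<g)

  Λ≐semigroup : Elem Λ ≐ (_∉ applyUpTo (gap (suc b)) g)
  Λ≐semigroup = ≐-trans Λ≐
    ( (λ n∉ → ∉-applyUpTo⁺ (gap (suc b)) λ j<g → ∉-applyUpTo⁻ x n∉ j<g ∘ trans (x≡gap j<g))
    , (λ n∉ → ∉-applyUpTo⁺ x λ j<g → ∉-applyUpTo⁻ (gap (suc b)) n∉ j<g ∘ trans (sym (x≡gap j<g))))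

  bound : suc b * 3 ≤ g + 1
  -- By minimality of `suc b`, 4b + 2 is not in `Λ`; it is therefore among the first `g` gaps, so
  -- its index `1 + b * 3` is below `g`.
  bound with (2 + b * 4) ∈? applyUpTo (gap (suc b)) g
  ... | no  ∉gaps = contradiction (a≤ b (proj₂ Λ≐semigroup ∉gaps)) 1+n≰n
  ... | yes ∈gaps with ∈-applyUpTo⁻ (gap (suc b)) ∈gaps
  ...   | k , k<g , 2+4b≡ = subst (suc b * 3 ≤_) (+-comm 1 g) (s≤s (subst (_< g)
    (increasing⇒injective gap-increasing (trans (sym 2+4b≡) (sym (gap-1+3* (suc b) b ≤-refl)))) k<g))

-- Counting the admissible parameters

theorem5p4 : ∀ (g : ℕ) → g ≥ 3 → HasCardinality (chainSemigroups g 4) ((g + 1) / 3)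
theorem5p4 g g≥3 = record
  -- Index `i` stands for a = i + 1; being below the quotient means 3a ≤ g + 1, that is 3a - 2 < g.
  { to        = λ i → semigroup (suc (toℕ i)) g , semigroup-inChain {suc (toℕ i)} (s≤s z≤n) g≥3
  ; cong      = λ { refl → ≐-refl }
  ; bijective = injective , surjective
  }
  where
  index-bound : (i : Fin ((g + 1) / 3)) → suc (toℕ i) * 3 ≤ g + 1
  index-bound i = ≤-trans (*-monoˡ-≤ 3 {suc (toℕ i)} (toℕ<n i)) (m/n*n≤m (g + 1) 3)

  injective : ∀ {i j} → semigroup (suc (toℕ i)) g ≈ₛ semigroup (suc (toℕ j)) g → i ≡ j
  injective {i} {j} (⊆ , ⊇) = toℕ-injective (suc-injective (≤-antisym
    (semigroup-⊆⇒≤ (suc (toℕ j)) (toℕ i) g (index-bound i) ⊇)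
    (semigroup-⊆⇒≤ (suc (toℕ i)) (toℕ j) g (index-bound j) ⊆)))

  surjective : ∀ y → ∃[ i ] (∀ {z} → z ≡ i → semigroup (suc (toℕ z)) g ≈ₛ proj₁ y)
  surjective (Λ , genus , mult , inChain) with classification Λ genus mult inChain
  ... | b , 3a≤g+1 , Λ≈ = fromℕ< b<n , λ { refl →
    ≐-trans (subst (λ c → semigroup (suc (toℕ (fromℕ< b<n))) g ≈ₛ semigroup (suc c) g)
                   (toℕ-fromℕ< b<n) ≐-refl)
            (≐-sym Λ≈) }
    where
    b<n : b < (g + 1) / 3
    b<n = subst (_≤ (g + 1) / 3) (m*n/n≡m (suc b) 3) (/-monoˡ-≤ 3 3a≤g+1)
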